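{- (1) Let $\mathcal{A}=(A,1,0,\vee,\wedge,\rightarrow,\neg,\sim)$ be a ccpBa (respectively, a c$\vee$cpBa). Let $X_A$ be the set of prime filters of $\mathcal{A}$, $\sigma(a)=\{P\in X_A : a\in P\}$ for $a\in A$, $\tau_{\mathcal{A}}$ the topology on $X_A$ generated by the subbasis $\{\sigma(a): a\in A\}\cup\{X_A\setminus\sigma(a): a\in A\}$, and $Y_0:=\sigma(\sim 1)$. Then: (a) $(X_A,\tau_{\mathcal{A}},\subseteq)$ is an Esakia space, and $Y_0$ is a clopen set in $\tau_{\mathcal{A}}$ satisfying $$\forall x\in X_A\,\bigl(\forall y\in X_A\,(x\subseteq y\Rightarrow\exists z\in X_A\,(y\subseteq z\ \&\ z\in Y_0))\Rightarrow x\in Y_0\bigr)$$ (respectively, this condition and also $\forall x,y\in X_A\,(x,y\notin Y_0\Rightarrow(x\subseteq y\Rightarrow y\subseteq x))$). (b) $\mathcal{D}(X_A):=(CpUp(X_A),X_A,\emptyset,\cup,\cap,\rightarrow,\neg,\sim)$ is a ccpBa (respectively, a c$\vee$cpBa). (c) The map $\Phi:A\to CpUp(X_A)$, $\Phi(a):=\sigma(a)$, is an isomorphism from $\mathcal{A}$ onto $\mathcal{D}(X_A)$. (2) Let $(X,\tau,\leq)$ be an Esakia space and $Y_0\subseteq X$ a clopen upset satisfying $$\forall x\in X\,\bigl(\forall y\in X\,(x\leq y\Rightarrow\exists z\in X\,(y\leq z\ \&\ z\in Y_0))\Rightarrow x\in Y_0\bigr)$$ (respectively, this condition and also $\forall x,y\in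 X\,(x,y\notin Y_0\Rightarrow(x\leq y\Rightarrow y\leq x))$). Then: (a) $\mathcal{D}(X):=(CpUp(X),X,\emptyset,\cup,\cap,\rightarrow,\neg,\sim)$ is a ccpBa (respectively, a c$\vee$cpBa). (b) $(X_{CpUp(X)},\tau_{\mathcal{D}(X)},\subseteq)$ is an Esakia space. Moreover, the set $\widetilde{Y_0}$ of all prime filters of $\mathcal{D}(X)$ containing $\sim X$ satisfies $$\forall x\in X_{CpUp(X)}\,\bigl(\forall y\in X_{CpUp(X)}\,(x\subseteq y\Rightarrow\exists z\in X_{CpUp(X)}\,(y\subseteq z\ \&\ z\in\widetilde{Y_0}))\Rightarrow x\in\widetilde{Y_0}\bigr);$$ and if $Y_0$ satisfies $\forall x,y\in X\,(x,y\notin Y_0\Rightarrow(x\leq y\Rightarrow y\leq x))$, then $\widetilde{Y_0}$ satisfies $\forall x,y\in X_{CpUp(X)}\,(x,y\notin\widetilde{Y_0}\Rightarrow(x\subseteq y\Rightarrow y\subseteq x))$. (c) $(X,\tau)$ is homeomorphic to $(X_{CpUp(X)},\tau_{\mathcal{D}(X)})$, and $(X,\leq)$ is order-isomorphic to $(X_{CpUp(X)},\subseteq)$.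
   Context: A relatively pseudo-complemented (rpc) lattice is a lattice with a binary operation $\rightarrow$ satisfying $a\wedge x\leq b\Leftrightarrow x\leq a\rightarrow b$; it has a greatest element $1$. A ccpBa (contrapositionally complemented pseudo-Boolean algebra) is an algebra $(A,1,0,\vee,\wedge,\rightarrow,\neg,\sim)$ such that $(A,1,0,\vee,\wedge,\rightarrow)$ is a bounded rpc lattice and, for all $a\in A$, $\neg a=a\rightarrow 0$ and $\sim a=a\rightarrow(\neg\neg\sim 1)$. A c$\vee$cpBa is a ccpBa in which $a\vee\sim a=1$ for all $a\in A$. In a poset $(X,\leq)$, an upset is a subset closed upwards, and $\downarrow Z=\{x\in X:\exists y\in Z,\ x\leq y\}$. A Priestley space is a triple $(X,\tau,\leq)$ with $(X,\leq)$ a poset and $\tau$ a compact topology on $X$ such that whenever $x\nleq y$ there is a clopen upset $Y$ with $x\in Y$, $y\notin Y$. An Esakia space is a Priestley space in which $\downarrow U$ is clopen for every clopen $U$. $CpUp(X)$ is the set of clopen upsets of $(X,\tau,\leq)$. For $U,V\in CpUp(X)$: $U\rightarrow V:=X\setminus\downarrow(U\setminus V)$, $\neg U:=U\rightarrow\emptyset$, $\sim X:=Y_0$ and $\sim U:=U\rightarrow Y_0$. In part (1) these operations are taken on $(X_A,\tau_{\mathcal{A}},\subseteq)$ with $Y_0=\sigma(\sim 1)$. For the algebra $\mathcal{D}(X)$ in part (2), $X_{CpUp(X)}$ and $\tau_{\mathcal{D}(X)}$ denote its set of prime filters and the topology on it obtained from $\mathcal{D}(X)$ exactly as $X_A$ and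 $\tau_{\mathcal{A}}$ are obtained from $\mathcal{A}$ in part (1). -}

module Defs where

open import Level using (Level; _⊔_; suc; Lift; lift; lower)
open import Data.List.Base using (List)
open import Data.List.Relation.Unary.Any using (Any)
open import Data.Product.Base using (Σ; Σ-syntax; ∃; _×_; _,_; proj₁; proj₂)
open import Data.Sum.Base using (_⊎_; inj₁; inj₂; [_,_])
open import Function.Base using (_∘_)
open import Function.Bundles using (Inverse)
open import Function.Definitions using (Congruent; Bijective)
open import Relation.Binary.Bundles using (Setoid; Poset)
open import Relation.Binary.Core using (Rel)
open import Relation.Binary.Definitions using (_Respects_)
open import Relation.Binary.Lattice.Structures using (IsHeytingAlgebra)
open import Relation.Binary.Morphism.Structures using (IsOrderIsomorphism)
open import Relation.Nullary.Negation.Core using (¬_)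
open import Relation.Unary
  using (Pred; _∈_; _∉_; _⊆_; _≐_; ∁; _∪_; _∩_; _∖_; ⋃)
open import Relation.Unary.Polymorphic using (∅; U)

------------------------------------------------------------------------
-- ccpBa's and c∨cpBa's

record RawCcpBa (c ℓ₁ ℓ₂ : Level) : Set (suc (c ⊔ ℓ₁ ⊔ ℓ₂)) where
  infix  4 _≈_ _≤_
  infixr 5 _⇨_
  infixr 6 _∨_
  infixr 7 _∧_
  infix  8 neg_ ∼_
  field
    Carrier : Set c
    _≈_     : Rel Carrier ℓ₁
    _≤_     : Rel Carrier ℓ₂
    𝟏 𝟎     : Carrier
    _∨_ _∧_ _⇨_ : Carrier → Carrier → Carrier
    neg_ ∼_ : Carrier → Carrier

-- A bounded relatively pseudo-complemented lattice is a Heyting algebra.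
record IsCcpBa {c ℓ₁ ℓ₂} (A : RawCcpBa c ℓ₁ ℓ₂) : Set (c ⊔ ℓ₁ ⊔ ℓ₂) where
  open RawCcpBa A
  field
    isHeytingAlgebra : IsHeytingAlgebra _≈_ _≤_ _∨_ _∧_ _⇨_ 𝟏 𝟎
    neg-def          : ∀ a → neg a ≈ a ⇨ 𝟎
    ∼-def            : ∀ a → ∼ a ≈ a ⇨ (neg (neg (∼ 𝟏)))

record IsC∨cpBa {c ℓ₁ ℓ₂} (A : RawCcpBa c ℓ₁ ℓ₂) : Set (c ⊔ ℓ₁ ⊔ ℓ₂) where
  open RawCcpBa A
  field
    isCcpBa  : IsCcpBa A
    ∨-∼-excl : ∀ a → a ∨ ∼ a ≈ 𝟏

record IsIsomorphism {a a₁ a₂ b b₁ b₂}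
                     (A : RawCcpBa a a₁ a₂) (B : RawCcpBa b b₁ b₂)
                     (f : RawCcpBa.Carrier A → RawCcpBa.Carrier B)
                     : Set (a ⊔ a₁ ⊔ b ⊔ b₁) where
  private
    module A = RawCcpBa A
    module B = RawCcpBa B
  field
    cong      : Congruent A._≈_ B._≈_ f
    bijective : Bijective A._≈_ B._≈_ f
    𝟏-homo    : f A.𝟏 B.≈ B.𝟏
    𝟎-homo    : f A.𝟎 B.≈ B.𝟎
    ∨-homo    : ∀ x y → f (x A.∨ y) B.≈ f x B.∨ f y
    ∧-homo    : ∀ x y → f (x A.∧ y) B.≈ f x B.∧ f y
    ⇨-homo    : ∀ x y → f (x A.⇨ y) B.≈ f x B.⇨ f y
    neg-homo  : ∀ x → f (A.neg x) B.≈ B.neg f x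
    ∼-homo    : ∀ x → f (A.∼ x) B.≈ B.∼ f x

------------------------------------------------------------------------
-- Topologies

-- Sets are setoids, so subsets must respect the equality of points and
-- families of subsets must respect ≐.  Unions are indexed by types of the
-- level s of the subsets; when s is at least the level of the points
-- (always the case below), this covers every family classically, since a
-- union of any family is the union of a subfamily indexed by its points.
-- The empty set is the empty union.
record IsTopology {c ℓ s o} (X : Setoid c ℓ)
                  (Open : Pred (Pred (Setoid.Carrier X) s) o)
                  : Set (c ⊔ ℓ ⊔ suc s ⊔ o) where
  open Setoid X
  field
    resp-≈ : ∀ {V} → Open V → V Respects _≈_
    resp-≐ : ∀ {V W} → V ≐ W → Open V → Open W
    U-open : Open U
    ∩-open : ∀ {V W} → Open V → Open W → Open (V ∩ W)
    ⋃-open : ∀ {I : Set s} (V : I → Pred Carrier s) →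
             (∀ i → Open (V i)) → Open (⋃ I V)

-- The least topology containing all the sets B j.
data Generated {c s j} {X : Set c} {J : Set j} (B : J → Pred X s)
               : Pred (Pred X s) (c ⊔ j ⊔ suc s) where
  subbasic : ∀ j → Generated B (B j)
  resp-≐   : ∀ {V W} → V ≐ W → Generated B V → Generated B W
  U-open   : Generated B U
  ∩-open   : ∀ {V W} → Generated B V → Generated B W → Generated B (V ∩ W)
  ⋃-open   : ∀ {I : Set s} (V : I → Pred X s) →
             (∀ i → Generated B (V i)) → Generated B (⋃ I V)

module _ {c s o} {X : Set c} (Open : Pred (Pred X s) o) where

  Clopen : Pred (Pred X s) o
  Clopen V = Open V × Open (∁ V)

  Compact : Set (c ⊔ suc s ⊔ o)
  Compact = ∀ {I : Set s} (V : I → Pred X s) → (∀ i → Open (V i)) →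
            (∀ x → ∃ λ i → x ∈ V i) →
            ∃ λ (is : List I) → ∀ x → Any (λ i → x ∈ V i) is

------------------------------------------------------------------------
-- Ordered topological spaces

-- The subsets are taken at level c ⊔ ℓ₂, the least one closed under ↓.
record OrderedSpace (c ℓ₁ ℓ₂ : Level) : Set (suc (suc (c ⊔ ℓ₁ ⊔ ℓ₂))) where
  field
    poset : Poset c ℓ₁ ℓ₂
  open Poset poset public
  Subset : Set (suc (c ⊔ ℓ₂))
  Subset = Pred Carrier (c ⊔ ℓ₂)
  field
    Open : Pred Subset (suc (c ⊔ ℓ₂))

  setoid : Setoid c ℓ₁
  setoid = Eq.setoid

module _ {c ℓ₁ ℓ₂} (S : OrderedSpace c ℓ₁ ℓ₂) where
  open OrderedSpace S

  Upset : Pred Subset (c ⊔ ℓ₂)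
  Upset V = ∀ {x y} → x ≤ y → x ∈ V → y ∈ V

  ↓ : Subset → Subset
  ↓ Z x = ∃ λ y → y ∈ Z × x ≤ y

  record IsPriestley : Set (suc (c ⊔ ℓ₂) ⊔ ℓ₁) where
    field
      isTopology : IsTopology setoid Open
      compact    : Compact Open
      separated  : ∀ {x y} → ¬ (x ≤ y) →
                   ∃ λ V → Clopen Open V × Upset V × x ∈ V × y ∉ V

  record IsEsakia : Set (suc (c ⊔ ℓ₂) ⊔ ℓ₁) where
    field
      isPriestley : IsPriestley
      ↓-clopen    : ∀ {V} → Clopen Open V → Clopen Open (↓ V)

  IsCpUp : Pred Subset (suc (c ⊔ ℓ₂))
  IsCpUp V = Clopen Open V × Upset V

  CpUp : Set (suc (c ⊔ ℓ₂))
  CpUp = ∃ IsCpUp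

  infixr 5 _⟶_
  _⟶_ : Subset → Subset → Subset
  V ⟶ W = ∁ (↓ (V ∖ W))

  Condition₁ : Pred Subset (c ⊔ ℓ₂)
  Condition₁ Y₀ =
    ∀ x → (∀ y → x ≤ y → ∃ λ z → y ≤ z × z ∈ Y₀) → x ∈ Y₀

  Condition₂ : Pred Subset (c ⊔ ℓ₂)
  Condition₂ Y₀ = ∀ x y → x ∉ Y₀ → y ∉ Y₀ → x ≤ y → y ≤ x

  -- The operations of 𝒟 are well defined: CpUp is closed under them, and
  -- the two prescriptions ∼ X = Y₀ and ∼ V = V ⟶ Y₀ agree at V = X.
  record WellDefined (Y₀ : CpUp) : Set (suc (c ⊔ ℓ₂)) where
    field
      U-cpUp : IsCpUp U
      ∅-cpUp : IsCpUp ∅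
      ∪-cpUp : ∀ {V W} → IsCpUp V → IsCpUp W → IsCpUp (V ∪ W)
      ∩-cpUp : ∀ {V W} → IsCpUp V → IsCpUp W → IsCpUp (V ∩ W)
      ⟶-cpUp : ∀ {V W} → IsCpUp V → IsCpUp W → IsCpUp (V ⟶ W)
      ∼-U    : (U ⟶ proj₁ Y₀) ≐ proj₁ Y₀

-- WellDefined is passed as evidence because closure under the operations
-- depends on excluded middle and on the space being an Esakia space; the
-- equality of 𝒟 ignores the evidence.
𝒟 : ∀ {c ℓ₁ ℓ₂} (S : OrderedSpace c ℓ₁ ℓ₂) (Y₀ : CpUp S) → WellDefined S Y₀ →
    RawCcpBa (suc (c ⊔ ℓ₂)) (c ⊔ ℓ₂) (c ⊔ ℓ₂)
𝒟 S Y₀ w = record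
  { Carrier = CpUp S
  ; _≈_     = λ V W → proj₁ V ≐ proj₁ W
  ; _≤_     = λ V W → proj₁ V ⊆ proj₁ W
  ; 𝟏       = U , U-cpUp
  ; 𝟎       = empty
  ; _∨_     = λ (V , p) (W , q) → V ∪ W , ∪-cpUp p q
  ; _∧_     = λ (V , p) (W , q) → V ∩ W , ∩-cpUp p q
  ; _⇨_     = imp
  ; neg_    = λ V → imp V empty
  ; ∼_      = λ V → imp V Y₀
  }
  where
  open WellDefined w
  empty : CpUp S
  empty = ∅ , ∅-cpUp
  imp : CpUp S → CpUp S → CpUp S
  imp (V , p) (W , q) = _⟶_ S V W , ⟶-cpUp p q

------------------------------------------------------------------------
-- The space of prime filters

module _ {c ℓ₁ ℓ₂} (A : RawCcpBa c ℓ₁ ℓ₂) where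
  open RawCcpBa A

  record IsPrimeFilter {p} (P : Pred Carrier p) : Set (c ⊔ ℓ₂ ⊔ p) where
    field
      𝟏∈     : 𝟏 ∈ P
      upward : ∀ {a b} → a ≤ b → a ∈ P → b ∈ P
      ∧-clos : ∀ {a b} → a ∈ P → b ∈ P → (a ∧ b) ∈ P
      proper : 𝟎 ∉ P
      prime  : ∀ {a b} → (a ∨ b) ∈ P → a ∈ P ⊎ b ∈ P

  PrimeFilter : Set (suc (c ⊔ ℓ₂))
  PrimeFilter = Σ[ P ∈ Pred Carrier (c ⊔ ℓ₂) ] IsPrimeFilter P

  primeFilters : Poset (suc (c ⊔ ℓ₂)) (c ⊔ ℓ₂) (c ⊔ ℓ₂)
  primeFilters = record
    { Carrier = PrimeFilter
    ; _≈_     = λ P Q → proj₁ P ≐ proj₁ Q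
    ; _≤_     = λ P Q → proj₁ P ⊆ proj₁ Q
    ; isPartialOrder = record
      { isPreorder = record
        { isEquivalence = record
          { refl  = (λ a → a) , (λ a → a)
          ; sym   = λ (f , g) → g , f
          ; trans = λ (f , g) (h , k) → (λ a → h (f a)) , (λ a → g (k a))
          }
        ; reflexive = proj₁
        ; trans     = λ f g a → g (f a)
        }
      ; antisym = λ f g → f , g
      }
    }

  -- Lift brings membership to the level of the subsets of the space.
  σ : Carrier → Pred PrimeFilter (suc (c ⊔ ℓ₂))
  σ a P = Lift (suc (c ⊔ ℓ₂)) (a ∈ proj₁ P)

  spectrum : OrderedSpace (suc (c ⊔ ℓ₂)) (c ⊔ ℓ₂) (c ⊔ ℓ₂)
  spectrum = record
    { poset = primeFilters
    ; Open  = Generated {J = Carrier ⊎ Carrier} [ σ , ∁ ∘ σ ]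
    }

  Φ : Carrier → CpUp spectrum
  Φ a = σ a , (subbasic (inj₁ a) , subbasic (inj₂ a))
            , λ P⊆Q a∈P → lift (P⊆Q (lower a∈P))

------------------------------------------------------------------------
-- Homeomorphism and order isomorphism

module _ {c ℓ₁ ℓ₂ c′ ℓ₁′ ℓ₂′}
         (S : OrderedSpace c ℓ₁ ℓ₂) (T : OrderedSpace c′ ℓ₁′ ℓ₂′) where
  private
    module S = OrderedSpace S
    module T = OrderedSpace T

  -- The preimage of V may live at a level other than that of the subsets
  -- of S, whence the detour through an open set W with the same points.
  Continuous : (S.Carrier → T.Carrier) → Set (suc (c ⊔ ℓ₂ ⊔ c′ ⊔ ℓ₂′))
  Continuous f = ∀ {V} → T.Open V → ∃ λ W → S.Open W × (W ≐ V ∘ f)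

  OrderIsomorphic : Set (c ⊔ ℓ₁ ⊔ ℓ₂ ⊔ c′ ⊔ ℓ₁′ ⊔ ℓ₂′)
  OrderIsomorphic =
    ∃ λ (f : S.Carrier → T.Carrier) →
      IsOrderIsomorphism S._≈_ T._≈_ S._≤_ T._≤_ f

Homeomorphic : ∀ {c ℓ₁ ℓ₂ c′ ℓ₁′ ℓ₂′} →
               OrderedSpace c ℓ₁ ℓ₂ → OrderedSpace c′ ℓ₁′ ℓ₂′ →
               Set (suc (c ⊔ ℓ₂ ⊔ c′ ⊔ ℓ₂′) ⊔ ℓ₁ ⊔ ℓ₁′)
Homeomorphic S T =
  Σ[ h ∈ Inverse (OrderedSpace.setoid S) (OrderedSpace.setoid T) ]
    Continuous S T (Inverse.to h) × Continuous T S (Inverse.from h)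

{-# OPTIONS --safe #-}

-- Excluded middle for all sets gives a choice operator, since existence is a
-- Σ-type and ¬ ¬ P → P produces witnesses.  Zorn's lemma then gives the prime
-- filter theorem, in a form relative to a quotient of the algebra.
--   * For the quotient by a prime filter P it yields ↓ (σ a ∖ σ b) = ∁ σ (a ⇨ b).
--   * For the quotient x ≤ y ⇔ "σ x ∖ σ y is finitely covered" it yields the
--     compactness of the spectrum.
-- Together these show that ↓ of a clopen set is the complement of some σ d, so
-- the spectrum is an Esakia space whose clopen upsets are exactly the sets σ d.
-- Since ∼ 1 = ¬ ¬ ∼ 1, the condition on Y₀ says that Y₀ is a regular element,
-- and a ∨ ∼ a = 1 says that points outside Y₀ have no proper successors
-- outside Y₀.
-- For an Esakia space X, a point is determined by the clopen upsets containing
-- it, and by compactness every prime filter of clopen upsets arises from a point.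
module Submission where

open import Defs
open import Axiom.ExcludedMiddle using (ExcludedMiddle)
open import Axiom.Extensionality.Propositional using (Extensionality)
open import Data.Bool.Base using (Bool; true; false; T; if_then_else_)
open import Data.Empty using (⊥)
open import Data.List.Base using (List; []; _∷_; _++_)
open import Data.List.Relation.Unary.Any using (Any; here; there)
open import Data.List.Relation.Unary.Any.Properties using (++⁺ˡ; ++⁺ʳ)
open import Data.Maybe.Base using (Maybe; just; nothing)
open import Data.Product.Base using (Σ; Σ-syntax; ∃; ∃₂; _×_; _,_; proj₁; proj₂)
open import Data.Sum.Base using (_⊎_; inj₁; inj₂; [_,_]) renaming (map to map-⊎)
open import Function.Base using (_∘_; id; case_of_)
open import Level using (Level; _⊔_; suc; Lift; lift; lower)
open import Relation.Binary.Core using (Rel)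
open import Relation.Binary.Definitions using (_Respects_)
open import Relation.Binary.Lattice.Bundles using (HeytingAlgebra)
open import Relation.Binary.Lattice.Structures using (IsHeytingAlgebra)
import Relation.Binary.Lattice.Properties.HeytingAlgebra as HeytingProperties
import Relation.Binary.Lattice.Properties.MeetSemilattice as MeetProperties
open import Relation.Binary.PropositionalEquality using (_≡_; refl; subst)
open import Relation.Nullary.Decidable
  using (yes; no; isYes; toWitness; fromWitness; decidable-stable)
open import Relation.Nullary.Negation using (¬_; contradiction)
open import Relation.Unary using (Pred; _∈_; _∉_; _⊆_; _≐_; ∁; _∪_; _∩_; _∖_; ⋃)
open import Relation.Unary.Polymorphic using (∅; U)

∁-involutive : (∀ {ℓ} → ExcludedMiddle ℓ) → ∀ {p q} {B : Set p} {V : Pred B q} → V ≐ ∁ (∁ V)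
∁-involutive em = (λ p q → q p) , λ p → decidable-stable em p

-- Zorn's lemma

-- Subsets are Bool-valued so that they are extensional and live at the lowest
-- level, whatever the level of the statement deciding membership.
module Zorn (em : ∀ {ℓ} → ExcludedMiddle ℓ) (ext : ∀ {a b} → Extensionality a b)
  {a g : Level} {A : Set a} where

  infix 4 _⊑_
  _⊑_ : (A → Bool) → (A → Bool) → Set a
  F ⊑ G = ∀ x → T (F x) → T (G x)

  -- Mutually included stages must become propositionally equal, since `grow` chooses its value and
  -- is not known to respect mutual inclusion.
  ⊑-antisym : ∀ {F G} → F ⊑ G → G ⊑ F → F ≡ G
  ⊑-antisym {F} {G} F⊑G G⊑F = ext λ x → T-injective (F⊑G x) (G⊑F x)
    where
    T-injective : ∀ {b c} → (T b → T c) → (T c → T b) → b ≡ c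
    T-injective {true}  {true}  _ _ = refl
    T-injective {true}  {false} f _ = contradiction _ f
    T-injective {false} {true}  _ f = contradiction _ f
    T-injective {false} {false} _ _ = refl

  ⨆ : ∀ {i} {I : Set i} → (I → A → Bool) → A → Bool
  ⨆ F x = isYes (em {P = ∃ λ i → T (F i x)})

  ⨆-upper : ∀ {i} {I : Set i} (F : I → A → Bool) i → F i ⊑ ⨆ F
  ⨆-upper F i x Fix = fromWitness (i , Fix)

  ⨆-least : ∀ {i} {I : Set i} (F : I → A → Bool) {G} → (∀ i → F i ⊑ G) → ⨆ F ⊑ G
  ⨆-least F F⊑G x p with toWitness p
  ... | i , Fix = F⊑G i x Fix

  module _ (Good : Pred (A → Bool) g)
    (⨆-good : ∀ {I : Set a} (F : I → A → Bool) → I → (∀ i j → F i ⊑ F j ⊎ F j ⊑ F i) →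
              (∀ i → Good (F i)) → Good (⨆ F))
    where

    Extension : (A → Bool) → Set (a ⊔ g)
    Extension F = ∃ λ G → Good G × F ⊑ G × ¬ G ⊑ F

    -- Excluded middle at a Σ-type serves as the choice function. A good fixed point of `grow` is a
    -- maximal good set.
    grow : (A → Bool) → A → Bool
    grow F with em {P = Extension F}
    ... | yes (G , _) = G
    ... | no _        = F

    grow-upper : ∀ F → F ⊑ grow F
    grow-upper F with em {P = Extension F}
    ... | yes (_ , _ , F⊑G , _) = F⊑G
    ... | no _                  = λ _ → id

    grow-good : ∀ {F} → Good F → Good (grow F)
    grow-good {F} good with em {P = Extension F}
    ... | yes (_ , G-good , _) = G-good
    ... | no _                 = good

    grow-fixed : ∀ {F} → grow F ⊑ F → ¬ Extension F
    grow-fixed {F} p with em {P = Extension F}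
    ... | yes (_ , _ , _ , G⋢F) = contradiction p G⋢F
    ... | no ¬ext               = ¬ext

    -- Codes for the stages of the transfinite iteration of `grow`, taking the place of ordinals.
    data Tower : Set (suc a) where
      next : Tower → Tower
      sup  : {I : Set a} → (I → Tower) → Tower

    module _ {F₀ : A → Bool} (F₀-good : Good F₀) where

      ⟦_⟧ : Tower → A → Bool
      -- Adding `F₀` to every family keeps unions nonempty and makes the supremum of the empty
      -- family the initial stage.
      family : {I : Set a} → (I → Tower) → Maybe I → A → Bool
      ⟦ next t ⟧ = grow ⟦ t ⟧
      ⟦ sup ts ⟧ = ⨆ (family ts)
      family ts (just i) = ⟦ ts i ⟧
      family ts nothing  = F₀

      F₀-least : ∀ t → F₀ ⊑ ⟦ t ⟧
      F₀-least (next t) x p = grow-upper ⟦ t ⟧ x (F₀-least t x p)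
      F₀-least (sup ts)     = ⨆-upper (family ts) nothing

      -- Mere comparability does not pass through the successor step. This stronger alternative
      -- does, and it can be used with the arguments exchanged because one of them has shrunk.
      grow⊑⊎⊒ : ∀ t u → grow ⟦ t ⟧ ⊑ ⟦ u ⟧ ⊎ ⟦ u ⟧ ⊑ ⟦ t ⟧
      grow⊑⊎⊒ t (next u) with grow⊑⊎⊒ t u
      ... | inj₁ gt⊑u = inj₁ λ x p → grow-upper ⟦ u ⟧ x (gt⊑u x p)
      ... | inj₂ u⊑t with grow⊑⊎⊒ u t
      ...   | inj₁ gu⊑t = inj₂ gu⊑t
      -- Here the two stages are equal, hence so are their images under `grow`.
      ...   | inj₂ t⊑u rewrite ⊑-antisym t⊑u u⊑t = inj₁ λ _ → id
      grow⊑⊎⊒ t (sup ts) with em {P = ∃ λ i → grow ⟦ t ⟧ ⊑ ⟦ ts i ⟧}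
      ... | yes (i , gt⊑) = inj₁ λ x p → ⨆-upper (family ts) (just i) x (gt⊑ x p)
      ... | no ¬gt⊑ = inj₂ (⨆-least (family ts) λ { nothing → F₀-least t ; (just i) → below i })
        where
        below : ∀ i → ⟦ ts i ⟧ ⊑ ⟦ t ⟧
        below i with grow⊑⊎⊒ t (ts i)
        ... | inj₁ gt⊑ = contradiction (i , gt⊑) ¬gt⊑
        ... | inj₂ ⊑t  = ⊑t

      tower-chain : ∀ t u → ⟦ t ⟧ ⊑ ⟦ u ⟧ ⊎ ⟦ u ⟧ ⊑ ⟦ t ⟧
      tower-chain t u with grow⊑⊎⊒ t u
      ... | inj₁ gt⊑u = inj₁ λ x p → gt⊑u x (grow-upper ⟦ t ⟧ x p)
      ... | inj₂ u⊑t  = inj₂ u⊑t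

      tower-good : ∀ t → Good ⟦ t ⟧
      tower-good (next t) = grow-good (tower-good t)
      tower-good (sup ts) = ⨆-good (family ts) nothing chain good
        where
        chain : ∀ i j → family ts i ⊑ family ts j ⊎ family ts j ⊑ family ts i
        chain (just i) (just j) = tower-chain (ts i) (ts j)
        chain nothing  (just j) = inj₁ (F₀-least (ts j))
        chain (just i) nothing  = inj₂ (F₀-least (ts i))
        chain nothing  nothing  = inj₁ λ _ → id
        good : ∀ i → Good (family ts i)
        good (just i) = tower-good (ts i)
        good nothing  = F₀-good

      -- The union of the whole tower, which is too large to index a union,
      -- is that of a subfamily indexed by its points.
      top : Tower
      top = sup {I = Σ A λ x → T (⨆ ⟦_⟧ x)} λ (x , p) → proj₁ (toWitness p)

      top-upper : ∀ t → ⟦ t ⟧ ⊑ ⟦ top ⟧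
      top-upper t x p = ⨆-upper (family _) (just (x , q)) x (proj₂ (toWitness q))
        where
        q : T (⨆ ⟦_⟧ x)
        q = ⨆-upper ⟦_⟧ t x p

      -- The stage `next top` lies below `top`, so `top` is a fixed point of `grow` and has no
      -- proper good extension.
      zorn : ∃ λ M → Good M × F₀ ⊑ M × (∀ {N} → Good N → M ⊑ N → N ⊑ M)
      zorn = ⟦ top ⟧ , tower-good top , F₀-least top , λ {N} N-good M⊑N →
        decidable-stable em λ N⋢M → grow-fixed (top-upper (next top)) (N , N-good , M⊑N , N⋢M)

-- Prime filters of a ccpBa, relative to a quotient order

module Spectrum (em : ∀ {ℓ} → ExcludedMiddle ℓ) (ext : ∀ {a b} → Extensionality a b)
  {c ℓ₁ ℓ₂ : Level} (A : RawCcpBa c ℓ₁ ℓ₂) (isCcpBa : IsCcpBa A) where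

  open RawCcpBa A
  open IsCcpBa isCcpBa
  open IsHeytingAlgebra isHeytingAlgebra
    renaming (refl to ≤-refl; trans to ≤-trans; antisym to ≤-antisym)
    using (module Eq; maximum; minimum; x≤x∨y; y≤x∨y; ∨-least; x∧y≤x; x∧y≤y; ∧-greatest;
           transpose-⇨; transpose-∧)

  private
    heytingAlgebra : HeytingAlgebra c ℓ₁ ℓ₂
    heytingAlgebra = record { isHeytingAlgebra = isHeytingAlgebra }

  open HeytingProperties heytingAlgebra
    using (⇨-eval; y≤x⇨y; ⇨-cong; ⇨-distribˡ-∧-≥; ⇨-distribˡ-∨-∧-≥; ∧-distribˡ-∨-≤)
  open MeetProperties (HeytingAlgebra.meetSemilattice heytingAlgebra) using (∧-monotonic)

  private
    X = spectrum A
    module X = OrderedSpace X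
  open X using (Open)

  -- These are the axioms for the order of a lattice quotient of the algebra. The prime filters of
  -- the quotient correspond to the prime filters closed under `R`.
  record IsQuotientOrder {r : Level} (R : Rel Carrier r) : Set (c ⊔ ℓ₂ ⊔ r) where
    field
      from-≤       : ∀ {x y} → x ≤ y → R x y
      R-trans      : ∀ {x y z} → R x y → R y z → R x z
      R-∧-greatest : ∀ {x y z} → R x y → R x z → R x (y ∧ z)
      R-∨-least    : ∀ {x y z} → R x z → R y z → R (x ∨ y) z

    ≤-R-trans : ∀ {x y z} → x ≤ y → R y z → R x z
    ≤-R-trans x≤y = R-trans (from-≤ x≤y)

    ∨-∧-elim : ∀ {x y z w} → R (z ∧ x) w → R (z ∧ y) w → R (z ∧ (x ∨ y)) w
    ∨-∧-elim p q = ≤-R-trans (∧-distribˡ-∨-≤ _ _ _) (R-∨-least p q)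

  module _ {r : Level} {R : Rel Carrier r} (isQuotientOrder : IsQuotientOrder R) where
    open IsQuotientOrder isQuotientOrder

    -- Zorn's lemma gives a maximal filter of the quotient among those containing `a` and avoiding
    -- `b`. It is prime: if it missed `x` and `y`, adjoining either one would bring in `b`, and by
    -- distributivity `x ∨ y` could not belong to it.
    prime-filter-theorem : ∀ {a b} → ¬ R a b →
      ∃ λ (Q : PrimeFilter A) →
        (∀ {x y} → R x y → x ∈ proj₁ Q → y ∈ proj₁ Q) × a ∈ proj₁ Q × b ∉ proj₁ Q
    prime-filter-theorem {a} {b} ¬Rab = prime (zorn Good ⨆-good principal-good)
      where
      open Zorn em ext {a = c} {g = c ⊔ r} {A = Carrier}

      record Good (F : Carrier → Bool) : Set (c ⊔ r) where
        field
          R-closed : ∀ {x y} → R x y → T (F x) → T (F y)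
          ∧-closed : ∀ {x y} → T (F x) → T (F y) → T (F (x ∧ y))
          a∈       : T (F a)
          b∉       : ¬ T (F b)
      open Good

      ⨆-good : ∀ {I : Set c} (F : I → Carrier → Bool) → I →
               (∀ i j → F i ⊑ F j ⊎ F j ⊑ F i) → (∀ i → Good (F i)) → Good (⨆ F)
      ⨆-good F i₀ chain good .R-closed Rxy p with toWitness p
      ... | i , p′ = ⨆-upper F i _ (R-closed (good i) Rxy p′)
      ⨆-good F i₀ chain good .∧-closed p q with toWitness p | toWitness q
      ... | i , p′ | j , q′ with chain i j
      ...   | inj₁ Fi⊑Fj = ⨆-upper F j _ (∧-closed (good j) (Fi⊑Fj _ p′) q′)
      ...   | inj₂ Fj⊑Fi = ⨆-upper F i _ (∧-closed (good i) p′ (Fj⊑Fi _ q′))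
      ⨆-good F i₀ chain good .a∈ = ⨆-upper F i₀ _ (a∈ (good i₀))
      ⨆-good F i₀ chain good .b∉ p with toWitness p
      ... | i , p′ = b∉ (good i) p′

      up : ∀ {s} → Pred Carrier s → Carrier → Bool
      up F y = isYes (em {P = ∃ λ x → x ∈ F × R x y})

      principal-good : Good (up (_≡ a))
      principal-good .R-closed Rxy p with toWitness p
      ... | _ , refl , Rax = fromWitness (a , refl , R-trans Rax Rxy)
      principal-good .∧-closed p q with toWitness p | toWitness q
      ... | _ , refl , Rax | _ , refl , Ray = fromWitness (a , refl , R-∧-greatest Rax Ray)
      principal-good .a∈ = fromWitness (a , refl , from-≤ ≤-refl)
      principal-good .b∉ p with toWitness p
      ... | _ , refl , Rab = ¬Rab Rab

      prime : (∃ λ M → Good M × up (_≡ a) ⊑ M × (∀ {N} → Good N → M ⊑ N → N ⊑ M)) →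
              ∃ λ (Q : PrimeFilter A) →
                (∀ {x y} → R x y → x ∈ proj₁ Q → y ∈ proj₁ Q) × a ∈ proj₁ Q × b ∉ proj₁ Q
      prime (M , M-good , _ , maximal) =
        ((λ x → Lift (c ⊔ ℓ₂) (T (M x))) , isPrimeFilter) ,
        (λ Rxy (lift p) → lift (R-closed M-good Rxy p)) , lift (a∈ M-good) , b∉ M-good ∘ lower
        where
        -- The filter of the quotient generated by `M` and `x`.
        adjoin : Carrier → Carrier → Bool
        adjoin x = up (λ z → ∃ λ m → T (M m) × z ≡ m ∧ x)

        adjoin-∋ : ∀ {x y m} → T (M m) → R (m ∧ x) y → T (adjoin x y)
        adjoin-∋ m∈M Rmxy = fromWitness (_ , (_ , m∈M , refl) , Rmxy)

        adjoin-good : ∀ {x} → ¬ T (adjoin x b) → Good (adjoin x)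
        adjoin-good ¬b .R-closed Ryz p with toWitness p
        ... | _ , (m , m∈M , refl) , Rmxy = adjoin-∋ m∈M (R-trans Rmxy Ryz)
        adjoin-good ¬b .∧-closed p q with toWitness p | toWitness q
        ... | _ , (m , m∈M , refl) , Rmxy | _ , (n , n∈M , refl) , Rnxz =
          adjoin-∋ (∧-closed M-good m∈M n∈M) (R-∧-greatest
            (≤-R-trans (∧-monotonic (x∧y≤x _ _) ≤-refl) Rmxy)
            (≤-R-trans (∧-monotonic (x∧y≤y _ _) ≤-refl) Rnxz))
        adjoin-good ¬b .a∈ = adjoin-∋ (a∈ M-good) (from-≤ (x∧y≤x _ _))
        adjoin-good ¬b .b∉ = ¬b

        -- By maximality of `M` the larger set `adjoin x` is not good, and avoiding `b` is the only
        -- requirement it can violate.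
        rejected : ∀ {x} → ¬ T (M x) → ∃ λ m → T (M m) × R (m ∧ x) b
        rejected {x} x∉M = decidable-stable em λ none → x∉M (maximal
          (adjoin-good λ p → let (_ , (m , m∈M , eq) , Rb) = toWitness p in
            none (m , m∈M , subst (λ z → R z b) eq Rb))
          (λ y y∈M → adjoin-∋ y∈M (from-≤ (x∧y≤x _ _)))
          x (adjoin-∋ (a∈ M-good) (from-≤ (x∧y≤y _ _))))

        M-prime : ∀ {x y} → T (M (x ∨ y)) → T (M x) ⊎ T (M y)
        M-prime {x} {y} x∨y∈M with em {P = T (M x)} | em {P = T (M y)}
        ... | yes x∈M | _       = inj₁ x∈M
        ... | no _    | yes y∈M = inj₂ y∈M
        ... | no x∉M  | no y∉M with rejected x∉M | rejected y∉M
        -- Both witnesses are weakened to `m ∧ n`; distributivity then relates `(m ∧ n) ∧ (x ∨ y)`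
        -- to `b` and forces `b` into `M`.
        ...   | m , m∈M , Rmx | n , n∈M , Rny = contradiction
          (R-closed M-good
            (∨-∧-elim (≤-R-trans (∧-monotonic (x∧y≤x _ _) ≤-refl) Rmx)
                      (≤-R-trans (∧-monotonic (x∧y≤y _ _) ≤-refl) Rny))
            (∧-closed M-good (∧-closed M-good m∈M n∈M) x∨y∈M))
          (b∉ M-good)

        isPrimeFilter : IsPrimeFilter A (λ x → Lift (c ⊔ ℓ₂) (T (M x)))
        isPrimeFilter = record
          { 𝟏∈     = lift (R-closed M-good (from-≤ (maximum a)) (a∈ M-good))
          ; upward = λ x≤y (lift p) → lift (R-closed M-good (from-≤ x≤y) p)
          ; ∧-clos = λ (lift p) (lift q) → lift (∧-closed M-good p q)
          ; proper = λ (lift p) → b∉ M-good (R-closed M-good (from-≤ (minimum b)) p)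
          ; prime  = λ (lift p) → map-⊎ lift lift (M-prime p)
          }

  module _ (P : PrimeFilter A) where
    open IsPrimeFilter (proj₂ P)

    modus-ponens : ∀ {a b} → (a ⇨ b) ∈ proj₁ P → a ∈ proj₁ P → b ∈ proj₁ P
    modus-ponens p q = upward ⇨-eval (∧-clos p q)

    -- This is the quotient of the Heyting algebra by the filter `P`, whose prime filters are those
    -- that contain `P`.
    ⇨-isQuotientOrder : IsQuotientOrder (λ x y → (x ⇨ y) ∈ proj₁ P)
    ⇨-isQuotientOrder = record
      { from-≤       = λ x≤y → upward (transpose-⇨ (≤-trans (x∧y≤y _ _) x≤y)) 𝟏∈
      ; R-trans      = λ p q → upward (transpose-⇨
          (≤-trans (∧-greatest (≤-trans (x∧y≤x _ _) (x∧y≤y _ _))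
                               (transpose-∧ (x∧y≤x _ _)))
                   ⇨-eval)) (∧-clos p q)
      ; R-∧-greatest = λ p q → upward (⇨-distribˡ-∧-≥ _ _ _) (∧-clos p q)
      ; R-∨-least    = λ p q → upward (⇨-distribˡ-∨-∧-≥ _ _ _) (∧-clos p q)
      }

    -- In the quotient by `P` each member of `P` lies above `𝟏`, so the prime filter found there
    -- contains `P`.
    ⇨-counterexample : ∀ {a b} → (a ⇨ b) ∉ proj₁ P →
      ∃ λ (Q : PrimeFilter A) → proj₁ P ⊆ proj₁ Q × a ∈ proj₁ Q × b ∉ proj₁ Q
    ⇨-counterexample a⇨b∉P with prime-filter-theorem ⇨-isQuotientOrder a⇨b∉P
    ... | Q , closed , a∈Q , b∉Q =
      Q , (λ x∈P → closed (upward y≤x⇨y x∈P) (IsPrimeFilter.𝟏∈ (proj₂ Q))) , a∈Q , b∉Q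

  ≤-isQuotientOrder : IsQuotientOrder _≤_
  ≤-isQuotientOrder = record
    { from-≤ = id ; R-trans = ≤-trans ; R-∧-greatest = ∧-greatest ; R-∨-least = ∨-least }

  σ-reflects-≤ : ∀ {a b} → σ A a ⊆ σ A b → a ≤ b
  σ-reflects-≤ σa⊆σb = decidable-stable em λ a≰b →
    let (Q , _ , a∈Q , b∉Q) = prime-filter-theorem ≤-isQuotientOrder a≰b in
    b∉Q (lower (σa⊆σb {Q} (lift a∈Q)))

  -- Basis and compactness of the spectrum

  basic : Carrier → Carrier → X.Subset
  basic a b = σ A a ∖ σ A b

  basic-open : ∀ a b → Open (basic a b)
  basic-open a b = ∩-open (subbasic (inj₁ a)) (subbasic (inj₂ b))

  -- By primeness the intersection of `basic a b` and `basic a′ b′` is `basic (a ∧ a′) (b ∨ b′)`,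
  -- while `𝟏` and `𝟎` fill the missing place for a single subbasic set.
  basic-neighbourhood : ∀ {V} → Open V → ∀ P → P ∈ V → ∃₂ λ a b → P ∈ basic a b × basic a b ⊆ V
  basic-neighbourhood (subbasic (inj₁ a)) P (lift a∈P) =
    a , 𝟎 , (lift a∈P , proper ∘ lower) , proj₁
    where open IsPrimeFilter (proj₂ P)
  basic-neighbourhood (subbasic (inj₂ b)) P b∉P =
    𝟏 , b , (lift 𝟏∈ , b∉P) , proj₂
    where open IsPrimeFilter (proj₂ P)
  basic-neighbourhood (resp-≐ (V⊆W , W⊆V) o) P P∈W with basic-neighbourhood o P (W⊆V P∈W)
  ... | a , b , P∈ab , ab⊆V = a , b , P∈ab , V⊆W ∘ ab⊆V
  basic-neighbourhood U-open P _ =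
    𝟏 , 𝟎 , (lift 𝟏∈ , proper ∘ lower) , _
    where open IsPrimeFilter (proj₂ P)
  basic-neighbourhood (∩-open o o′) P (P∈V , P∈W)
    with basic-neighbourhood o P P∈V | basic-neighbourhood o′ P P∈W
  ... | a , b , (lift a∈P , b∉P) , ab⊆V | a′ , b′ , (lift a′∈P , b′∉P) , ab⊆W =
    a ∧ a′ , b ∨ b′ , (lift (∧-clos a∈P a′∈P) , λ (lift p) → [ b∉P ∘ lift , b′∉P ∘ lift ] (prime p)) ,
    λ {Q} (lift p , q) → let open IsPrimeFilter (proj₂ Q) using () renaming (upward to up) in
      ab⊆V (lift (up (x∧y≤x _ _) p) , λ (lift r) → q (lift (up (x≤x∨y _ _) r))) ,
      ab⊆W (lift (up (x∧y≤y _ _) p) , λ (lift r) → q (lift (up (y≤x∨y _ _) r)))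
    where open IsPrimeFilter (proj₂ P)
  basic-neighbourhood (⋃-open V o) P (i , P∈Vi) with basic-neighbourhood (o i) P P∈Vi
  ... | a , b , P∈ab , ab⊆Vi = a , b , P∈ab , λ Q∈ab → i , ab⊆Vi Q∈ab

  -- If `R 𝟏 𝟎` failed, there would be a prime filter `Q` closed under `R`. Some `V i` contains a
  -- basic neighbourhood `basic a b` of `Q`; the single index `i` gives `R a b`, so `b` would belong
  -- to `Q`.
  compact : Compact Open
  compact {I} V V-open covers =
    let (is , p) = R𝟏𝟎 in
    is , λ P → let open IsPrimeFilter (proj₂ P) in p P (𝟏∈ , proper)
    where
    R : Rel Carrier _
    R a b = ∃ λ (is : List I) → ∀ P → a ∈ proj₁ P × b ∉ proj₁ P → Any (λ i → P ∈ V i) is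

    -- Transitivity and the two lattice axioms for `R` each reduce to one basic set being contained
    -- in the union of two others.
    split : ∀ {a b a′ b′ x y} → R a b → R a′ b′ →
            (∀ P → x ∈ proj₁ P × y ∉ proj₁ P →
              (a ∈ proj₁ P × b ∉ proj₁ P) ⊎ (a′ ∈ proj₁ P × b′ ∉ proj₁ P)) →
            R x y
    split (is , p) (js , q) cases =
      is ++ js , λ P xy → [ ++⁺ˡ ∘ p P , ++⁺ʳ is ∘ q P ] (cases P xy)

    isQuotientOrder : IsQuotientOrder R
    isQuotientOrder = record
      { from-≤ = λ x≤y → [] , λ P (x∈P , y∉P) →
          contradiction (IsPrimeFilter.upward (proj₂ P) x≤y x∈P) y∉P
      ; R-trans = λ {x} {y} {z} p q → split p q λ P (x∈P , z∉P) → case em {P = y ∈ proj₁ P} of λ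
          { (yes y∈P) → inj₂ (y∈P , z∉P) ; (no y∉P) → inj₁ (x∈P , y∉P) }
      ; R-∧-greatest = λ {x} {y} {z} p q → split p q λ P (x∈P , y∧z∉P) → case em {P = y ∈ proj₁ P} of λ
          { (yes y∈P) → inj₂ (x∈P , y∧z∉P ∘ IsPrimeFilter.∧-clos (proj₂ P) y∈P)
          ; (no y∉P)  → inj₁ (x∈P , y∉P) }
      ; R-∨-least = λ p q → split p q λ P (x∨y∈P , z∉P) →
          map-⊎ (_, z∉P) (_, z∉P) (IsPrimeFilter.prime (proj₂ P) x∨y∈P)
      }

    R𝟏𝟎 : R 𝟏 𝟎
    R𝟏𝟎 = decidable-stable em λ ¬R →
      let (Q , closed , _)                           = prime-filter-theorem isQuotientOrder ¬R
          (i , Q∈Vi)                                 = covers Q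
          (a , b , (lift a∈Q , b∉Q) , ab⊆Vi)         = basic-neighbourhood (V-open i) Q Q∈Vi
      in b∉Q (lift (closed (i ∷ [] , λ P (a∈P , b∉P) → here (ab⊆Vi (lift a∈P , b∉P ∘ lower))) a∈Q))

  isTopology : IsTopology X.setoid Open
  isTopology = record
    { resp-≈ = resp-≈ ; resp-≐ = resp-≐ ; U-open = U-open ; ∩-open = ∩-open ; ⋃-open = ⋃-open }
    where
    resp-≈ : ∀ {V} → Open V → V Respects X._≈_
    resp-≈ (subbasic (inj₁ a)) (P⊆Q , _) (lift a∈P) = lift (P⊆Q a∈P)
    resp-≈ (subbasic (inj₂ a)) (_ , Q⊆P) a∉P (lift a∈Q) = a∉P (lift (Q⊆P a∈Q))
    resp-≈ (resp-≐ (V⊆W , W⊆V) o) P≐Q P∈W = V⊆W (resp-≈ o P≐Q (W⊆V P∈W))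
    resp-≈ U-open P≐Q _ = _
    resp-≈ (∩-open o o′) P≐Q (p , q) = resp-≈ o P≐Q p , resp-≈ o′ P≐Q q
    resp-≈ (⋃-open V o) P≐Q (i , p) = i , resp-≈ (o i) P≐Q p

  isPriestley : IsPriestley X
  isPriestley = record
    { isTopology = isTopology
    ; compact    = compact
    ; separated  = λ {P} {Q} P⊈Q →
        let (a , a∈P , a∉Q) = decidable-stable em λ none →
              P⊈Q λ {a} a∈P → decidable-stable em λ a∉Q → none (a , a∈P , a∉Q)
        in σ A a , (subbasic (inj₁ a) , subbasic (inj₂ a)) ,
           (λ P⊆Q (lift a∈P) → lift (P⊆Q a∈P)) , lift a∈P , a∉Q ∘ lower
    }

  -- Implication, down-closures and clopen upsets in the spectrum

  σ-⇨ : ∀ a b → σ A (a ⇨ b) ≐ _⟶_ X (σ A a) (σ A b)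
  σ-⇨ a b =
    (λ {P} (lift p) (Q , (lift a∈Q , b∉Q) , P⊆Q) → b∉Q (lift (modus-ponens Q (P⊆Q p) a∈Q))) ,
    (λ {P} p → decidable-stable em λ a⇨b∉P →
      let (Q , P⊆Q , a∈Q , b∉Q) = ⇨-counterexample P (a⇨b∉P ∘ lift) in
      p (Q , (lift a∈Q , b∉Q ∘ lower) , P⊆Q))

  -- By compactness V is a finite union of sets σ a ∖ σ b, and the
  -- complement of ↓ (σ a ∖ σ b) is σ (a ⇨ b).
  ↓-clopen-principal : ∀ {V} → Clopen Open V → ∃ λ d → ↓ X V ≐ ∁ (σ A d)
  ↓-clopen-principal {V} (V-open , ∁V-open) =
    let (d , d∉⇒ , ⇒d∉) = cofactor (proj₁ cover) in
    d , (λ {P} (Q , Q∈V , P⊆Q) → ⇒d∉ P Q Q∈V P⊆Q (proj₂ cover Q)) , λ {P} → d∉⇒ P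
    where
    -- The basic subsets of `V` are completed by `∁ V` (index `nothing`), since compactness concerns
    -- covers of the whole space.
    I : Set (suc (c ⊔ ℓ₂))
    I = Maybe (∃₂ λ a b → basic a b ⊆ V)

    W : I → X.Subset
    W (just (a , b , _)) = basic a b
    W nothing            = ∁ V

    W-open : ∀ i → Open (W i)
    W-open (just (a , b , _)) = basic-open a b
    W-open nothing            = ∁V-open

    W-covers : ∀ P → ∃ λ i → P ∈ W i
    W-covers P with em {P = P ∈ V}
    ... | no P∉V  = nothing , P∉V
    ... | yes P∈V with basic-neighbourhood V-open P P∈V
    ...   | a , b , P∈ab , ab⊆V = just (a , b , ab⊆V) , P∈ab

    cover : ∃ λ (is : List I) → ∀ P → Any (λ i → P ∈ W i) is
    cover = compact W W-open W-covers

    -- The element `d` is the meet of the `a ⇨ b` over the `just` entries of the list. Coverage is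
    -- asked only of the one point `Q`, which lets the recursion run over partial covers.
    cofactor : (is : List I) → ∃ λ d → (∀ P → P ∉ σ A d → P ∈ ↓ X V) ×
      (∀ P Q → Q ∈ V → proj₁ P ⊆ proj₁ Q → Any (λ i → Q ∈ W i) is → P ∉ σ A d)
    cofactor [] = 𝟏 , (λ P 𝟏∉P → contradiction (lift (IsPrimeFilter.𝟏∈ (proj₂ P))) 𝟏∉P) , λ _ _ _ _ ()
    cofactor (nothing ∷ is) with cofactor is
    ... | d , d∉⇒ , ⇒d∉ = d , d∉⇒ , λ
      { P Q Q∈V P⊆Q (here Q∉V) → contradiction Q∈V Q∉V
      ; P Q Q∈V P⊆Q (there p)  → ⇒d∉ P Q Q∈V P⊆Q p }
    cofactor (just (a , b , ab⊆V) ∷ is) with cofactor is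
    ... | d , d∉⇒ , ⇒d∉ = (a ⇨ b) ∧ d , ∉⇒ , λ
      { P Q Q∈V P⊆Q (here (lift a∈Q , b∉Q)) (lift p) →
          b∉Q (lift (modus-ponens Q (P⊆Q (IsPrimeFilter.upward (proj₂ P) (x∧y≤x _ _) p)) a∈Q))
      ; P Q Q∈V P⊆Q (there r) (lift p) →
          ⇒d∉ P Q Q∈V P⊆Q r (lift (IsPrimeFilter.upward (proj₂ P) (x∧y≤y _ _) p)) }
      where
      ∉⇒ : ∀ P → P ∉ σ A ((a ⇨ b) ∧ d) → P ∈ ↓ X V
      ∉⇒ P p with em {P = (a ⇨ b) ∈ proj₁ P}
      ... | yes q = d∉⇒ P λ (lift d∈P) → p (lift (IsPrimeFilter.∧-clos (proj₂ P) q d∈P))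
      ... | no q with ⇨-counterexample P q
      ...   | Q , P⊆Q , a∈Q , b∉Q = Q , ab⊆V (lift a∈Q , b∉Q ∘ lower) , P⊆Q

  isEsakia : IsEsakia X
  isEsakia = record
    { isPriestley = isPriestley
    ; ↓-clopen    = λ {V} V-clopen → principal-clopen (↓-clopen-principal {V} V-clopen)
    }
    where
    principal-clopen : ∀ {V} → (∃ λ d → V ≐ ∁ (σ A d)) → Clopen Open V
    principal-clopen (d , p , q) =
      resp-≐ (q , p) (subbasic (inj₂ d)) ,
      resp-≐ ((λ {P} d∈P r → p {P} r d∈P) , λ {P} r → decidable-stable em λ d∉P → r (q {P} d∉P))
        (subbasic (inj₁ d))

  -- The complement of an upset is a downset, so `↓` leaves `∁ V` unchanged and `↓-clopen-principal`
  -- describes it. This makes `Φ` surjective.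
  cpUp-principal : ∀ {V} → IsCpUp X V → ∃ λ d → σ A d ≐ V
  cpUp-principal {V} ((V-open , ∁V-open) , upset) =
    principal (↓-clopen-principal {∁ V} (∁V-open , resp-≐ (∁-involutive em) V-open))
    where
    principal : (∃ λ d → ↓ X (∁ V) ≐ ∁ (σ A d)) → ∃ λ d → σ A d ≐ V
    principal (d , p , q) = d ,
      (λ {P} d∈P → decidable-stable em λ P∉V → p {P} (P , P∉V , λ {_} r → r) d∈P) ,
      (λ {P} P∈V → decidable-stable em λ d∉P →
        let (Q , Q∉V , P⊆Q) = q {P} d∉P in Q∉V (upset (λ {a} → P⊆Q {a}) P∈V))

  -- The defining equation of `∼` is taken at `𝟏`, where `𝟏 ⇨ x` equals `x`.
  ∼𝟏-regular : ∼ 𝟏 ≈ neg (neg (∼ 𝟏))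
  ∼𝟏-regular = Eq.trans (∼-def 𝟏) (≤-antisym (≤-trans (∧-greatest ≤-refl (maximum _)) ⇨-eval) y≤x⇨y)

  ∼-⇨ : ∀ a → ∼ a ≈ a ⇨ ∼ 𝟏
  ∼-⇨ a = Eq.trans (∼-def a) (⇨-cong Eq.refl (Eq.sym ∼𝟏-regular))

-- The algebra of clopen upsets of an Esakia space

module EsakiaSpace (em : ∀ {ℓ} → ExcludedMiddle ℓ)
  {x m n : Level} (X : OrderedSpace x m n) (isEsakia : IsEsakia X) where

  open OrderedSpace X using (Carrier; Subset; Open; _≈_; _≤_)
    renaming (refl to ≤-refl; trans to ≤-trans; antisym to ≤-antisym; reflexive to ≤-reflexive)
  open IsEsakia isEsakia
  open IsPriestley isPriestley
  private module X = IsTopology isTopology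

  ∁-clopen : ∀ {V} → Clopen Open V → Clopen Open (∁ V)
  ∁-clopen (V-open , ∁V-open) = ∁V-open , X.resp-≐ (∁-involutive em) V-open

  ∅-open : Open ∅
  ∅-open = X.resp-≐ ((λ ()) , λ ()) (X.⋃-open {I = Lift (x ⊔ n) ⊥} (λ ()) (λ ()))

  ∪-open : ∀ {V W} → Open V → Open W → Open (V ∪ W)
  ∪-open {V} {W} V-open W-open = X.resp-≐
    ( (λ { (lift true , p) → inj₁ p ; (lift false , p) → inj₂ p })
    , [ (λ p → lift true , p) , (λ p → lift false , p) ])
    (X.⋃-open {I = Lift (x ⊔ n) Bool} (λ (lift b) → if b then V else W)
      λ { (lift true) → V-open ; (lift false) → W-open })

  ∩-clopen : ∀ {V W} → Clopen Open V → Clopen Open W → Clopen Open (V ∩ W)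
  ∩-clopen {V} {W} (V-open , ∁V-open) (W-open , ∁W-open) =
    X.∩-open V-open W-open , X.resp-≐ de-morgan (∪-open ∁V-open ∁W-open)
    where
    de-morgan : (∁ V ∪ ∁ W) ≐ ∁ (V ∩ W)
    de-morgan = [ (λ p (q , _) → p q) , (λ p (_ , q) → p q) ] , λ {z} p → case em {P = z ∈ V} of λ
      { (yes z∈V) → inj₂ λ z∈W → p (z∈V , z∈W) ; (no z∉V) → inj₁ z∉V }

  -- The union is re-indexed by its own points, with an index chosen for each. Stating membership
  -- through `isYes` brings the new index type down to the level that `IsTopology` admits.
  ⋃-large-open : ∀ {i} {I : Set i} (V : I → Subset) → (∀ i → Open (V i)) →
                 ∃ λ W → Open W × W ≐ ⋃ I V
  ⋃-large-open {I = I} V V-open =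
    ⋃ J (λ (_ , p) → V (index p)) , X.⋃-open (λ (_ , p) → V (index p)) (λ (_ , p) → V-open (index p)) ,
    (λ { ((_ , p) , q) → index p , q }) ,
    (λ {z} z∈⋃ → (lift z , fromWitness z∈⋃) , member {z} (fromWitness z∈⋃))
    where
    index : ∀ {z} → T (isYes (em {P = z ∈ ⋃ I V})) → I
    index p = proj₁ (toWitness p)
    member : ∀ {z} (p : T (isYes (em {P = z ∈ ⋃ I V}))) → z ∈ V (index p)
    member p = proj₂ (toWitness p)
    J : Set (x ⊔ n)
    J = Σ (Lift (x ⊔ n) Carrier) λ (lift z) → T (isYes (em {P = z ∈ ⋃ I V}))

  module _ (Y₀ : CpUp X) where

    wellDefined : WellDefined X Y₀
    wellDefined = record
      { U-cpUp = (X.U-open , X.resp-≐ ((λ ()) , λ p → contradiction _ p) ∅-open) , λ _ _ → _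
      ; ∅-cpUp = (∅-open , X.resp-≐ ((λ _ ()) , λ _ → _) X.U-open) , λ _ ()
      ; ∪-cpUp = λ ((V-open , ∁V-open) , V-up) ((W-open , ∁W-open) , W-up) →
          ( ∪-open V-open W-open
          , X.resp-≐ ((λ (p , q) → [ p , q ]) , λ p → p ∘ inj₁ , p ∘ inj₂) (X.∩-open ∁V-open ∁W-open)) ,
          λ y≤z → map-⊎ (V-up y≤z) (W-up y≤z)
      ; ∩-cpUp = λ (V-clopen , V-up) (W-clopen , W-up) →
          ∩-clopen V-clopen W-clopen , λ y≤z (p , q) → V-up y≤z p , W-up y≤z q
      ; ⟶-cpUp = λ (V-clopen , _) (W-clopen , _) →
          ∁-clopen (↓-clopen (∩-clopen V-clopen (∁-clopen W-clopen))) ,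
          λ y≤z y∉↓ (u , u∈ , z≤u) → y∉↓ (u , u∈ , ≤-trans y≤z z≤u)
      ; ∼-U    =
          (λ {y} p → decidable-stable em λ y∉Y₀ → p (y , (_ , y∉Y₀) , ≤-refl)) ,
          (λ y∈Y₀ (z , (_ , z∉Y₀) , y≤z) → z∉Y₀ (proj₂ (proj₂ Y₀) y≤z y∈Y₀))
      }

    D = 𝒟 X Y₀ wellDefined
    module D = RawCcpBa D

    isHeytingAlgebra : IsHeytingAlgebra D._≈_ D._≤_ D._∨_ D._∧_ D._⇨_ D.𝟏 D.𝟎
    isHeytingAlgebra = record
      { isBoundedLattice = record
        { isLattice = record
          { isPartialOrder = record
            { isPreorder = record
              { isEquivalence = record
                { refl  = id , id
                ; sym   = λ (f , g) → g , f
                ; trans = λ (f , g) (h , k) → h ∘ f , g ∘ k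
                }
              ; reflexive = proj₁
              ; trans     = λ f g → g ∘ f
              }
            ; antisym = λ f g → f , g
            }
          ; supremum = λ _ _ → inj₁ , inj₂ , λ _ f g → [ f , g ]
          ; infimum  = λ _ _ → proj₁ , proj₂ , λ _ f g p → f p , g p
          }
        ; maximum = λ _ _ → _
        ; minimum = λ _ ()
        }
      ; exponential = λ (_ , _ , V-up) _ _ →
          (λ V∩W⊆Z v∈V (z , (z∈W , z∉Z) , v≤z) → z∉Z (V∩W⊆Z (V-up v≤z v∈V , z∈W))) ,
          (λ V⊆W⟶Z {v} (v∈V , v∈W) → decidable-stable em λ v∉Z →
            V⊆W⟶Z v∈V (v , (v∈W , v∉Z) , ≤-refl))
      }

    module _ (condition₁ : Condition₁ X (proj₁ Y₀)) where

      isCcpBa : IsCcpBa D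
      isCcpBa = record
        { isHeytingAlgebra = isHeytingAlgebra
        ; neg-def          = λ _ → id , id
        ; ∼-def            = λ (V , _) →
            (λ p (z , (z∈V , z∉¬¬∼U) , y≤z) →
              p (z , (z∈V , λ z∈Y₀ → z∉¬¬∼U (Y₀⊆¬¬∼U z∈Y₀)) , y≤z)) ,
            (λ p (z , (z∈V , z∉Y₀) , y≤z) →
              p (z , (z∈V , λ z∈¬¬∼U → z∉Y₀ (¬¬∼U⊆Y₀ z∈¬¬∼U)) , y≤z))
        }
        where
        Y₀⊆¬¬∼U : proj₁ Y₀ ⊆ proj₁ (D.neg D.neg (D.∼ D.𝟏))
        Y₀⊆¬¬∼U y∈Y₀ (z , (z∈¬ , _) , y≤z) =
          z∈¬ (z , (proj₂ (WellDefined.∼-U wellDefined) (proj₂ (proj₂ Y₀) y≤z y∈Y₀) , λ ()) , ≤-refl)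

        -- A point lies in the double negation of `Y₀` when each of its successors has a successor
        -- in `Y₀`, which is the premise of `condition₁`.
        ¬¬∼U⊆Y₀ : proj₁ (D.neg D.neg (D.∼ D.𝟏)) ⊆ proj₁ Y₀
        ¬¬∼U⊆Y₀ {y} y∈¬¬ = condition₁ y λ z y≤z → decidable-stable em λ none →
          y∈¬¬ (z , ((λ (u , (u∈∼U , _) , z≤u) →
            none (u , z≤u , proj₁ (WellDefined.∼-U wellDefined) u∈∼U)) , λ ()) , y≤z)

      -- Suppose `y` is outside `V` and some `z` above `y` lies in `V` but not in `Y₀`. Then `y` is
      -- outside the upset `Y₀` too, so `z ≤ y` and `y` would be in `V`.
      isC∨cpBa : Condition₂ X (proj₁ Y₀) → IsC∨cpBa D
      isC∨cpBa condition₂ = record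
        { isCcpBa  = isCcpBa
        ; ∨-∼-excl = λ (V , _ , V-up) → _ , λ {y} _ → case em {P = y ∈ V} of λ
            { (yes y∈V) → inj₁ y∈V
            ; (no y∉V)  → inj₂ λ (z , (z∈V , z∉Y₀) , y≤z) →
                y∉V (V-up (condition₂ y z (z∉Y₀ ∘ proj₂ (proj₂ Y₀) y≤z) z∉Y₀ y≤z) z∈V)
            }
        }

    -- Points as prime filters of clopen upsets

    X̃ = spectrum D
    module X̃ = OrderedSpace X̃

    cpUps-at : Carrier → X̃.Carrier
    cpUps-at y = (λ (V , _) → Lift (suc (x ⊔ n)) (y ∈ V)) , record
      { 𝟏∈     = _
      ; upward = λ V⊆W (lift p) → lift (V⊆W p)
      ; ∧-clos = λ (lift p) (lift q) → lift (p , q)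
      ; proper = λ ()
      ; prime  = λ (lift p) → map-⊎ lift lift p
      }

    cpUps-at-mono : ∀ {y z} → y ≤ z → cpUps-at y X̃.≤ cpUps-at z
    cpUps-at-mono y≤z {_ , _ , V-up} (lift p) = lift (V-up y≤z p)

    cpUps-at-cong : ∀ {y z} → y ≈ z → cpUps-at y X̃.≈ cpUps-at z
    cpUps-at-cong y≈z = (λ {V} → cpUps-at-mono (≤-reflexive y≈z) {V}) ,
                        (λ {V} → cpUps-at-mono (≤-reflexive (OrderedSpace.Eq.sym X y≈z)) {V})

    cpUps-at-cancel : ∀ {y z} → cpUps-at y X̃.≤ cpUps-at z → y ≤ z
    cpUps-at-cancel ỹ⊆z̃ = decidable-stable em λ y≰z →
      let (V , V-clopen , V-up , y∈V , z∉V) = separated y≰z in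
      z∉V (lower (ỹ⊆z̃ {V , V-clopen , λ {u} {v} → V-up {u} {v}} (lift y∈V)))

    -- If no point lay in exactly the members of P, then each point would lie
    -- in the complement of a member or in a non-member.  By compactness a
    -- finite meet of members would be below a finite join of non-members.
    locate : ∀ P → ∃ λ y → cpUps-at y X̃.≈ P
    locate P@(P∋ , P-prime) = decidable-stable em λ none → absurd none
      where
      open IsPrimeFilter P-prime

      Misplaced : Carrier → Set (suc (x ⊔ n))
      Misplaced y = ∃ λ (V : CpUp X) → (V ∈ P∋ × y ∉ proj₁ V) ⊎ (V ∉ P∋ × y ∈ proj₁ V)

      side : ∀ {y} → Misplaced y → Subset
      side (V , inj₁ _) = ∁ (proj₁ V)
      side (V , inj₂ _) = proj₁ V

      side-open : ∀ {y} (p : Misplaced y) → Open (side p)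
      side-open ((_ , (_ , ∁V-open) , _) , inj₁ _) = ∁V-open
      side-open ((_ , (V-open , _) , _) , inj₂ _)  = V-open

      ∈-side : ∀ {y} (p : Misplaced y) → y ∈ side p
      ∈-side (_ , inj₁ (_ , y∉V)) = y∉V
      ∈-side (_ , inj₂ (_ , y∈V)) = y∈V

      module _ (misplaced : ∀ y → Misplaced y) where

        I : Set (x ⊔ n)
        I = Lift (x ⊔ n) Carrier

        W : I → Subset
        W (lift y) = side (misplaced y)

        -- Invariant of the recursion over a finite subcover: `A` is a meet of members and `B` a
        -- join of non-members. For a full cover it says that `A` is below `B`.
        Separating : List I → Set (suc (x ⊔ n))
        Separating is = ∃₂ λ A B → A ∈ P∋ × B ∉ P∋ ×
          (∀ z → z ∈ proj₁ A → Any (λ i → z ∈ W i) is → z ∈ proj₁ B)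

        separating : ∀ is → Separating is
        separating [] = D.𝟏 , D.𝟎 , 𝟏∈ , proper , λ _ _ ()
        separating (lift y ∷ is) = extend (misplaced y) refl (separating is)
          where
          -- The equation carries membership in `side (misplaced y)` over to the case being matched.
          extend : ∀ p → misplaced y ≡ p → Separating is → Separating (lift y ∷ is)
          extend (V , inj₁ (V∈P , _)) eq (A , B , A∈P , B∉P , sep) =
            V D.∧ A , B , ∧-clos V∈P A∈P , B∉P , λ
              { z (z∈V , _) (here p)  → contradiction z∈V (subst (λ q → z ∈ side q) eq p)
              ; z (_ , z∈A) (there p) → sep z z∈A p }
          extend (V , inj₂ (V∉P , _)) eq (A , B , A∈P , B∉P , sep) =
            A , V D.∨ B , A∈P , [ V∉P , B∉P ] ∘ prime , λ
              { z z∈A (here p)  → inj₁ (subst (λ q → z ∈ side q) eq p)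
              ; z z∈A (there p) → inj₂ (sep z z∈A p) }

        misplaced-absurd : ⊥
        misplaced-absurd =
          let (is , covers)             = compact W (λ (lift y) → side-open (misplaced y))
                                                  (λ y → lift y , ∈-side (misplaced y))
              (A , B , A∈P , B∉P , sep) = separating is
          in B∉P (upward {A} {B} (λ {z} z∈A → sep z z∈A (covers z)) A∈P)

      absurd : ¬ ¬ (∃ λ y → cpUps-at y X̃.≈ P)
      absurd none = misplaced-absurd λ y → decidable-stable em λ placed → none (y ,
        (λ {V} (lift y∈V) → decidable-stable em λ V∉P → placed (V , inj₂ (V∉P , y∈V))) ,
        (λ {V} V∈P → lift (decidable-stable em λ y∉V → placed (V , inj₁ (V∈P , y∉V)))))

    locus : X̃.Carrier → Carrier
    locus P = proj₁ (locate P)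

    locus-cong : ∀ {P Q} → P X̃.≈ Q → locus P ≈ locus Q
    locus-cong {P} {Q} (P⊆Q , Q⊆P) = ≤-antisym (below {P} {Q} P⊆Q) (below {Q} {P} Q⊆P)
      where
      below : ∀ {P Q} → P X̃.≤ Q → locus P ≤ locus Q
      below {P} {Q} P⊆Q = cpUps-at-cancel λ {V} p →
        proj₂ (proj₂ (locate Q)) {V} (P⊆Q (proj₁ (proj₂ (locate P)) {V} p))

    -- By antisymmetry `y ≤ z` or `z ≤ y` fails for each `z` outside `V`, so a clopen upset
    -- separates the two points. By compactness finitely many separators suffice; their `A` are
    -- intersected and their `B` united.
    cpUps-neighbourhood : ∀ {V} → Open V → ∀ {y} → y ∈ V →
      ∃₂ λ (A B : CpUp X) → y ∈ proj₁ A ∖ proj₁ B × proj₁ A ∖ proj₁ B ⊆ V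
    cpUps-neighbourhood {V} V-open {y} y∈V = shrink cover
      where
      I : Set (x ⊔ n)
      I = Maybe (Σ Carrier (_∉ V))

      Separator : Carrier → Set (suc (x ⊔ n))
      Separator z = ∃₂ λ (A B : CpUp X) → y ∈ proj₁ A ∖ proj₁ B × z ∈ (∁ (proj₁ A) ∪ proj₁ B)

      separator : ∀ {z} → z ∉ V → Separator z
      separator {z} z∉V with em {P = y ≤ z} | em {P = z ≤ y}
      ... | yes y≤z | yes z≤y = contradiction (X.resp-≈ V-open (≤-antisym y≤z z≤y) y∈V) z∉V
      ... | no y≰z  | _ with separated y≰z
      ...   | A , A-clopen , A-up , y∈A , z∉A =
        (A , A-clopen , λ {u} {v} → A-up {u} {v}) , D.𝟎 , (y∈A , λ ()) , inj₁ z∉A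
      separator {z} z∉V | yes _ | no z≰y with separated z≰y
      ... | B , B-clopen , B-up , z∈B , y∉B =
        D.𝟏 , (B , B-clopen , λ {u} {v} → B-up {u} {v}) , (_ , y∉B) , inj₂ z∈B

      W : I → Subset
      W nothing          = V
      W (just (z , z∉V)) = let (A , B , _) = separator z∉V in ∁ (proj₁ A) ∪ proj₁ B

      W-open : ∀ i → Open (W i)
      W-open nothing          = V-open
      W-open (just (z , z∉V)) =
        let ((_ , (_ , ∁A-open) , _) , (_ , (B-open , _) , _) , _) = separator z∉V in
        ∪-open ∁A-open B-open

      cover : ∃ λ (is : List I) → ∀ z → Any (λ i → z ∈ W i) is
      cover = compact W W-open λ z → case em {P = z ∈ V} of λ
        { (yes z∈V) → nothing , z∈V
        ; (no z∉V)  → just (z , z∉V) , proj₂ (proj₂ (proj₂ (separator z∉V))) }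

      Shrunk : List I → Set (suc (x ⊔ n))
      Shrunk is = ∃₂ λ (A B : CpUp X) → y ∈ proj₁ A ∖ proj₁ B ×
        (∀ z → z ∈ proj₁ A ∖ proj₁ B → Any (λ i → z ∈ W i) is → z ∈ V)

      shrunk : ∀ is → Shrunk is
      shrunk [] = D.𝟏 , D.𝟎 , (_ , λ ()) , λ _ _ ()
      shrunk (nothing ∷ is) =
        let (A , B , y∈ , ⊆V) = shrunk is in
        A , B , y∈ , λ { z _ (here z∈V) → z∈V ; z z∈ (there p) → ⊆V z z∈ p }
      shrunk (just (z , z∉V) ∷ is) =
        let (A , B , (y∈A , y∉B) , ⊆V)    = shrunk is
            (A′ , B′ , (y∈A′ , y∉B′) , _) = separator z∉V
        in A′ D.∧ A , B′ D.∨ B , ((y∈A′ , y∈A) , [ y∉B′ , y∉B ]) , λ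
          { z ((z∈A′ , _) , z∉) (here (inj₁ z∉A′)) → contradiction z∈A′ z∉A′
          ; z (_ , z∉) (here (inj₂ z∈B′))          → contradiction (inj₁ z∈B′) z∉
          ; z ((_ , z∈A) , z∉) (there p)           → ⊆V z (z∈A , z∉ ∘ inj₂) p }

      shrink : (∃ λ (is : List I) → ∀ z → Any (λ i → z ∈ W i) is) →
        ∃₂ λ (A B : CpUp X) → y ∈ proj₁ A ∖ proj₁ B × proj₁ A ∖ proj₁ B ⊆ V
      shrink (is , covers) =
        let (A , B , y∈ , ⊆V) = shrunk is in A , B , y∈ , λ {z} z∈ → ⊆V z z∈ (covers z)

    cpUps-at-continuous : Continuous X X̃ cpUps-at
    cpUps-at-continuous (subbasic (inj₁ (V , (V-open , _) , _))) =
      V , V-open , (λ p → lift (lift p)) , λ (lift (lift p)) → p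
    cpUps-at-continuous (subbasic (inj₂ (V , (_ , ∁V-open) , _))) =
      ∁ V , ∁V-open , (λ p (lift (lift q)) → p q) , λ p q → p (lift (lift q))
    cpUps-at-continuous (resp-≐ (V⊆V′ , V′⊆V) o) with cpUps-at-continuous o
    ... | W , W-open , W⊆ , ⊆W = W , W-open , V⊆V′ ∘ W⊆ , ⊆W ∘ V′⊆V
    cpUps-at-continuous U-open = U , X.U-open , _
    cpUps-at-continuous (∩-open o o′) with cpUps-at-continuous o | cpUps-at-continuous o′
    ... | W , W-open , W⊆ , ⊆W | W′ , W′-open , W′⊆ , ⊆W′ =
      W ∩ W′ , X.∩-open W-open W′-open ,
      (λ (p , q) → W⊆ p , W′⊆ q) , λ (p , q) → ⊆W p , ⊆W′ q
    cpUps-at-continuous (⋃-open V o) =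
      -- Unions in the spectrum have index types of a higher level than those in `X`.
      let W i = proj₁ (cpUps-at-continuous (o i))
          (Z , Z-open , Z⊆ , ⊆Z) =
            ⋃-large-open W (λ i → proj₁ (proj₂ (cpUps-at-continuous (o i))))
      in Z , Z-open ,
        (λ p → let (i , q) = Z⊆ p in i , proj₁ (proj₂ (proj₂ (cpUps-at-continuous (o i)))) q) ,
        (λ (i , p) → ⊆Z (i , proj₂ (proj₂ (proj₂ (cpUps-at-continuous (o i)))) p))

    -- By `cpUps-neighbourhood`, `V` is the union of the differences of clopen upsets inside it, and
    -- the preimage of such a difference under `locus` is the difference of the corresponding sets
    -- `σ`.
    locus-continuous : Continuous X̃ X locus
    locus-continuous {V} V-open =
      ⋃ J W , ⋃-open W (λ (lift (A , B , _)) → ∩-open (subbasic (inj₁ A)) (subbasic (inj₂ B))) ,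
      (λ { {P} (lift (A , B , A∖B⊆V) , lift A∈P , B∉P) → A∖B⊆V
        ( lower (proj₂ (proj₂ (locate P)) {A} A∈P)
        , λ p → B∉P (lift (proj₁ (proj₂ (locate P)) {B} (lift p)))) }) ,
      (λ {P} p → let (A , B , (y∈A , y∉B) , A∖B⊆V) = cpUps-neighbourhood V-open p in
        lift (A , B , λ {z} → A∖B⊆V {z}) ,
        lift (proj₁ (proj₂ (locate P)) {A} (lift y∈A)) ,
        λ (lift B∈P) → y∉B (lower (proj₂ (proj₂ (locate P)) {B} B∈P)))
      where
      J : Set (suc (suc (x ⊔ n)))
      J = Lift _ (∃₂ λ (A B : CpUp X) → proj₁ A ∖ proj₁ B ⊆ V)
      W : J → X̃.Subset
      W (lift (A , B , _)) = σ D A ∖ σ D B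

    homeomorphic : Homeomorphic X X̃
    homeomorphic = record
      { to        = cpUps-at
      ; from      = locus
      ; to-cong   = cpUps-at-cong
      ; from-cong = λ {P} {Q} → locus-cong {P} {Q}
      ; inverse   =
          (λ {P} {y} y≈ → X̃.Eq.trans {cpUps-at y} {cpUps-at (locus P)} {P}
            (cpUps-at-cong y≈) (proj₂ (locate P))) ,
          (λ {y} {P} (P⊆ , ⊆P) → let (ỹ⊆P , P⊆ỹ) = proj₂ (locate P) in ≤-antisym
            (cpUps-at-cancel λ {V} p → P⊆ {V} (ỹ⊆P {V} p))
            (cpUps-at-cancel λ {V} p → P⊆ỹ {V} (⊆P {V} p)))
      } , cpUps-at-continuous , locus-continuous

    orderIsomorphic : OrderIsomorphic X X̃
    orderIsomorphic = cpUps-at , record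
      { isOrderMonomorphism = record
        { isOrderHomomorphism = record
          { cong = cpUps-at-cong
          ; mono = λ y≤z {V} → cpUps-at-mono y≤z {V}
          }
        ; injective = λ (ỹ⊆z̃ , z̃⊆ỹ) → ≤-antisym (cpUps-at-cancel λ {V} → ỹ⊆z̃ {V})
                                          (cpUps-at-cancel λ {V} → z̃⊆ỹ {V})
        ; cancel    = cpUps-at-cancel
        }
      ; surjective = λ P → locus P , λ {y} y≈ → X̃.Eq.trans {cpUps-at y} {cpUps-at (locus P)} {P}
          (cpUps-at-cong y≈) (proj₂ (locate P))
      }

-- The conditions on `σ (∼ 𝟏)` and the isomorphism `Φ`

module CcpBaDuality (em : ∀ {ℓ} → ExcludedMiddle ℓ) (ext : ∀ {a b} → Extensionality a b)
  {c ℓ₁ ℓ₂ : Level} (A : RawCcpBa c ℓ₁ ℓ₂) (isCcpBa : IsCcpBa A) where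

  open RawCcpBa A
  open IsCcpBa isCcpBa using (isHeytingAlgebra; neg-def)
  open IsHeytingAlgebra isHeytingAlgebra
    using (module Eq; antisym; reflexive; x∧y≤x; x∧y≤y; x≤x∨y; y≤x∨y)
  open Spectrum em ext A isCcpBa public
    using (isEsakia; σ-⇨; σ-reflects-≤; ⇨-counterexample; modus-ponens; cpUp-principal; ∼𝟏-regular; ∼-⇨)

  private
    X = spectrum A
    module X = OrderedSpace X

  σ-mono : ∀ {a b} → a ≤ b → σ A a ⊆ σ A b
  σ-mono a≤b {P} (lift a∈P) = lift (IsPrimeFilter.upward (proj₂ P) a≤b a∈P)

  σ-cong : ∀ {a b} → a ≈ b → σ A a ≐ σ A b
  σ-cong a≈b = (λ {P} → σ-mono (reflexive a≈b) {P}) , (λ {P} → σ-mono (reflexive (Eq.sym a≈b)) {P})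

  -- If `P` missed `∼ 𝟏`, which equals `neg (∼ 𝟏) ⇨ 𝟎`, some prime filter `Q` above `P` would
  -- contain `neg (∼ 𝟏)`. The assumed `Z` above `Q` contains `∼ 𝟏` as well, so it would be improper.
  condition₁ : Condition₁ X (σ A (∼ 𝟏))
  condition₁ P dense = σ-mono (reflexive (Eq.sym ∼𝟏≈⇨)) {P} (lift
    (decidable-stable em λ p → absurd (⇨-counterexample P p)))
    where
    ∼𝟏≈⇨ : ∼ 𝟏 ≈ (neg (∼ 𝟏)) ⇨ 𝟎
    ∼𝟏≈⇨ = Eq.trans ∼𝟏-regular (neg-def (neg (∼ 𝟏)))

    absurd : ¬ (∃ λ (Q : PrimeFilter A) →
      proj₁ P ⊆ proj₁ Q × neg (∼ 𝟏) ∈ proj₁ Q × 𝟎 ∉ proj₁ Q)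
    absurd (Q , P⊆Q , ¬∼𝟏∈Q , _) =
      let (Z , Q⊆Z , lift ∼𝟏∈Z) = dense Q (λ {a} → P⊆Q {a})
          open IsPrimeFilter (proj₂ Z)
      in proper (modus-ponens Z (upward (reflexive (neg-def (∼ 𝟏))) (Q⊆Z ¬∼𝟏∈Q)) ∼𝟏∈Z)

  -- For `a` in `Q`, one of `a` and `∼ a` is in `P`. The latter would put `a ⇨ ∼ 𝟏` into `Q`, and
  -- with it `∼ 𝟏`.
  condition₂ : IsC∨cpBa A → Condition₂ X (σ A (∼ 𝟏))
  condition₂ isC∨cpBa P Q ∼𝟏∉P ∼𝟏∉Q P⊆Q {a} a∈Q =
    [ id , (λ ∼a∈P → contradiction
      (lift (modus-ponens Q (IsPrimeFilter.upward (proj₂ Q) (reflexive (∼-⇨ a)) (P⊆Q ∼a∈P)) a∈Q))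
      ∼𝟏∉Q) ]
    (prime (upward (reflexive (Eq.sym (IsC∨cpBa.∨-∼-excl isC∨cpBa a))) 𝟏∈))
    where open IsPrimeFilter (proj₂ P)

  isIsomorphism : (w : WellDefined X (Φ A (∼ 𝟏))) → IsIsomorphism A (𝒟 X (Φ A (∼ 𝟏)) w) (Φ A)
  isIsomorphism w = record
    { cong      = σ-cong
    ; bijective =
        (λ (p , q) → antisym (σ-reflects-≤ λ {P} → p {P}) (σ-reflects-≤ λ {P} → q {P})) ,
        λ (V , V-cpUp) → surjective (cpUp-principal V-cpUp)
    ; 𝟏-homo    = _ , λ {P} _ → lift (IsPrimeFilter.𝟏∈ (proj₂ P))
    ; 𝟎-homo    = (λ {P} (lift p) → contradiction p (IsPrimeFilter.proper (proj₂ P))) , λ ()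
    ; ∨-homo    = λ a b →
        (λ {P} (lift p) → map-⊎ lift lift (IsPrimeFilter.prime (proj₂ P) p)) ,
        λ {P} → [ σ-mono (x≤x∨y a b) {P} , σ-mono (y≤x∨y a b) {P} ]
    ; ∧-homo    = λ a b →
        (λ {P} p → σ-mono (x∧y≤x a b) {P} p , σ-mono (x∧y≤y a b) {P} p) ,
        λ {P} (lift p , lift q) → lift (IsPrimeFilter.∧-clos (proj₂ P) p q)
    ; ⇨-homo    = σ-⇨
    -- Properness makes `σ 𝟎` empty, which adapts `σ-⇨ a 𝟎` to the bottom `∅` of `𝒟`.
    ; neg-homo  = λ a →
        (λ {P} p (Q , (a∈Q , _) , P⊆Q) → proj₁ (σ-⇨ a 𝟎) {P} (σ-mono (reflexive (neg-def a)) {P} p)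
          (Q , (a∈Q , λ (lift q) → IsPrimeFilter.proper (proj₂ Q) q) , λ {b} → P⊆Q {b})) ,
        (λ {P} p → σ-mono (reflexive (Eq.sym (neg-def a))) {P} (proj₂ (σ-⇨ a 𝟎) {P}
          λ (Q , (a∈Q , _) , P⊆Q) → p (Q , (a∈Q , λ ()) , λ {b} → P⊆Q {b})))
    ; ∼-homo    = λ a →
        (λ {P} p → proj₁ (σ-⇨ a (∼ 𝟏)) {P} (σ-mono (reflexive (∼-⇨ a)) {P} p)) ,
        (λ {P} p → σ-mono (reflexive (Eq.sym (∼-⇨ a))) {P} (proj₂ (σ-⇨ a (∼ 𝟏)) {P} p))
    }
    where
    surjective : ∀ {V} → (∃ λ a → σ A a ≐ V) → ∃ λ a → ∀ {b} → b ≈ a → σ A b ≐ V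
    surjective (a , σa⊆V , V⊆σa) = a , λ b≈a →
      (λ {P} p → σa⊆V (σ-mono (reflexive b≈a) {P} p)) ,
      (λ {P} p → σ-mono (reflexive (Eq.sym b≈a)) {P} (V⊆σa p))

theorem2p12 :
    (∀ {ℓ} → ExcludedMiddle ℓ) → (∀ {a b} → Extensionality a b) →
    ∀ {c ℓ₁ ℓ₂ x m n} →
      ((A : RawCcpBa c ℓ₁ ℓ₂) → IsCcpBa A →
        let open RawCcpBa A
            X  = spectrum A
            Y₀ = σ A (∼ 𝟏)
        in
        (IsEsakia X × Clopen (OrderedSpace.Open X) Y₀ × Condition₁ X Y₀ ×
          (IsC∨cpBa A → Condition₂ X Y₀)) ×
        (Σ[ w ∈ WellDefined X (Φ A (∼ 𝟏)) ]
          ((IsCcpBa (𝒟 X (Φ A (∼ 𝟏)) w) ×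
            (IsC∨cpBa A → IsC∨cpBa (𝒟 X (Φ A (∼ 𝟏)) w))) ×
           IsIsomorphism A (𝒟 X (Φ A (∼ 𝟏)) w) (Φ A))))
      ×
      ((X : OrderedSpace x m n) → IsEsakia X →
        (Y₀ : CpUp X) → Condition₁ X (proj₁ Y₀) →
        Σ[ w ∈ WellDefined X Y₀ ]
          (let D  = 𝒟 X Y₀ w
               X̃  = spectrum D
               Ỹ₀ = σ D (RawCcpBa.∼_ D (RawCcpBa.𝟏 D))
           in
           (IsCcpBa D × (Condition₂ X (proj₁ Y₀) → IsC∨cpBa D)) ×
           (IsEsakia X̃ × Condition₁ X̃ Ỹ₀ ×
             (Condition₂ X (proj₁ Y₀) → Condition₂ X̃ Ỹ₀)) ×
           (Homeomorphic X X̃ × OrderIsomorphic X X̃)))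
theorem2p12 em ext =
  (λ A isCcpBa →
    let module A  = CcpBaDuality em ext A isCcpBa
        -- The laws of `𝒟` over the spectrum are those of the clopen upsets of any Esakia space.
        module X  = EsakiaSpace em (spectrum A) A.isEsakia
        Y₀        = Φ A (RawCcpBa.∼_ A (RawCcpBa.𝟏 A))
    in
    (A.isEsakia , proj₁ (proj₂ Y₀) , A.condition₁ , A.condition₂) ,
    X.wellDefined Y₀ ,
    (X.isCcpBa Y₀ A.condition₁ , λ isC∨cpBa → X.isC∨cpBa Y₀ A.condition₁ (A.condition₂ isC∨cpBa)) ,
    A.isIsomorphism (X.wellDefined Y₀)) ,
  λ X isEsakia Y₀ condition₁ →
    let module X = EsakiaSpace em X isEsakia
        -- The claims about the prime filters of `𝒟` are the first half of the theorem applied to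
        -- this ccpBa.
        module D = CcpBaDuality em ext (X.D Y₀) (X.isCcpBa Y₀ condition₁)
    in
    X.wellDefined Y₀ ,
    (X.isCcpBa Y₀ condition₁ , X.isC∨cpBa Y₀ condition₁) ,
    (D.isEsakia , D.condition₁ , D.condition₂ ∘ X.isC∨cpBa Y₀ condition₁) ,
    X.homeomorphic Y₀ , X.orderIsomorphic Y₀
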